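{- Let $(\mathcal{C},\mathsf{I},\otimes,\lambda,\rho,\alpha)$ be a left-skew monoidal category, let $(T,\eta,\mu)$ be a monoid in it, and let $(\mathcal{E},\mathcal{M})$ be an orthogonal factorization system on $\mathcal{C}$ such that $\mathcal{E}$ is closed under $(-)\otimes S$ for every object $(S,s)$ of $\mathcal{M}/T$ (i.e. $e\otimes S\in\mathcal{E}$ whenever $e\in\mathcal{E}$). Then $(\mathcal{M}/T, \mathsf{J}, \boxdot, \ell, r, a)$, as defined in the context, is a left-skew monoidal category. If $\lambda$ is a natural isomorphism (the skew monoidal category $\mathcal{C}$ is left-normal), then so is $\ell$. If moreover $\mathcal{E}$ is also closed under $S\otimes(-)$ for every object $(S,s)$ of $\mathcal{M}/T$ and $(\mathcal{C},\mathsf{I},\otimes,\lambda,\rho,\alpha)$ is monoidal (i.e. $\lambda,\rho,\alpha$ are all isomorphisms), then $(\mathcal{M}/T,\mathsf{J},\boxdot,\ell,r,a)$ is monoidal.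
   Context: A left-skew monoidal category consists of a category $\mathcal{C}$, an object $\mathsf{I}$, a functor $\otimes:\mathcal{C}\times\mathcal{C}\to\mathcal{C}$ and natural transformations (not necessarily invertible) $\lambda_X:\mathsf{I}\otimes X\to X$, $\rho_X : X\to X\otimes \mathsf{I}$, $\alpha_{X,Y,Z}:(X\otimes Y)\otimes Z\to X\otimes(Y\otimes Z)$ satisfying: $\lambda_{\mathsf{I}}\circ\rho_{\mathsf{I}} = \mathrm{id}$; $(X\otimes\lambda_Y)\circ\alpha_{X,\mathsf{I},Y}\circ(\rho_X\otimes Y) = \mathrm{id}$; $\lambda_{X\otimes Y}\circ\alpha_{\mathsf{I},X,Y} = \lambda_X\otimes Y$; $\alpha_{X,Y,\mathsf{I}}\circ\rho_{X\otimes Y} = X\otimes\rho_Y$; $(X\otimes\alpha_{Y,Z,W})\circ\alpha_{X,Y\otimes Z,W}\circ(\alpha_{X,Y,Z}\otimes W) = \alpha_{X,Y,Z\otimes W}\circ\alpha_{X\otimes Y,Z,W}$. It is monoidal if $\lambda,\rho,\alpha$ are all isomorphisms. A monoid is $(T,\eta:\mathsf{I}\to T,\mu:T\otimes T\to T)$ with $\mu\circ(\eta\otimes T) = \lambda_T$, $\mu\circ(T\otimes\eta)\circ\rho_T = \mathrm{id}_T$, $\mu\circ(\mu\otimes T) = \mu\circ(T\otimes\mu)\circ\alpha_{T,T,T}$. An orthogonal factorization system $(\mathcal{E},\mathcal{M})$ on $\mathcal{C}$: both classes contain all isomorphisms and are closed under composition; for every commuting square $g\circ e = m\circ f$ with $e\in\mathcal{E}$,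 $m\in\mathcal{M}$ there is a unique $d$ with $d\circ e = f$ and $m\circ d = g$; every morphism factors as $m\circ e$ with $e\in\mathcal{E}$, $m\in\mathcal{M}$. $\mathcal{M}/T$ is the category with objects $(S,s)$, $s:S\to T$ in $\mathcal{M}$, and morphisms $f:(S,s)\to(S',s')$ the $f:S\to S'$ with $s'\circ f = s$. Structure on $\mathcal{M}/T$: factor $\eta = j\circ q$ with $q:\mathsf{I}\to\mathsf{J}$ in $\mathcal{E}$, $j:\mathsf{J}\to T$ in $\mathcal{M}$; the unit is $(\mathsf{J},j)$. For objects $(S,s),(S',s')$ factor $\mu\circ(s\otimes s') = (s\boxdot s')\circ q_{S,S'}$ with $q_{S,S'}:S\otimes S'\to S\boxdot S'$ in $\mathcal{E}$, $s\boxdot s'$ in $\mathcal{M}$; the tensor is $(S\boxdot S', s\boxdot s')$. For morphisms $f:(S_1,s_1)\to(S_2,s_2)$, $f':(S'_1,s'_1)\to(S'_2,s'_2)$, $f\boxdot f'$ is the unique morphism with $(f\boxdot f')\circ q_{S_1,S'_1} = q_{S_2,S'_2}\circ(f\otimes f')$ and $(s_2\boxdot s'_2)\circ(f\boxdot f') = s_1\boxdot s'_1$. The left unitor $\ell_S : \mathsf{J}\boxdot S\to S$ is the unique morphism with $\ell_S\circ q_{\mathsf{J},S}\circ(q\otimes S) = \lambda_S$ and $s\circ\ell_S = j\boxdot s$. The right unitor is $r_S = q_{S,\mathsf{J}}\circ(S\otimes q)\circ\rho_S : S\to S\boxdot\mathsf{J}$. The associator $a_{S,S',S''} : (S\boxdot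 S')\boxdot S''\to S\boxdot(S'\boxdot S'')$ is the unique morphism with $a\circ q_{S\boxdot S',S''}\circ(q_{S,S'}\otimes S'') = q_{S,S'\boxdot S''}\circ(S\otimes q_{S',S''})\circ\alpha_{S,S',S''}$ and $(s\boxdot(s'\boxdot s''))\circ a = (s\boxdot s')\boxdot s''$. (These diagonals exist and are unique by orthogonality, using closure of $\mathcal{E}$ under $(-)\otimes S$.) -}

module Defs where

open import Level using (Level; _⊔_; suc)
open import Relation.Binary using (Rel; IsEquivalence; Setoid)
import Relation.Binary.Reasoning.Setoid as SetoidReasoning

-- Categories have hom-setoids: equality of morphisms is the relation _≈_,
-- and objects are never compared.
record Category (o ℓ e : Level) : Set (suc (o ⊔ ℓ ⊔ e)) where
  infix  4 _≈_ _⇒_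
  infixr 9 _∘_
  field
    Obj : Set o
    _⇒_ : Obj → Obj → Set ℓ
    _≈_ : ∀ {X Y} → Rel (X ⇒ Y) e
    id  : ∀ {X} → X ⇒ X
    _∘_ : ∀ {X Y Z} → Y ⇒ Z → X ⇒ Y → X ⇒ Z

    equiv     : ∀ {X Y} → IsEquivalence (_≈_ {X} {Y})
    ∘-resp-≈  : ∀ {X Y Z} {f g : Y ⇒ Z} {h i : X ⇒ Y} → f ≈ g → h ≈ i → f ∘ h ≈ g ∘ i
    identityˡ : ∀ {X Y} {f : X ⇒ Y} → id ∘ f ≈ f
    identityʳ : ∀ {X Y} {f : X ⇒ Y} → f ∘ id ≈ f
    assoc     : ∀ {W X Y Z} {f : W ⇒ X} {g : X ⇒ Y} {h : Y ⇒ Z} →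
                (h ∘ g) ∘ f ≈ h ∘ (g ∘ f)

  homSetoid : Obj → Obj → Setoid ℓ e
  homSetoid X Y = record { Carrier = X ⇒ Y ; _≈_ = _≈_ ; isEquivalence = equiv }

  module Equiv {X Y : Obj} = IsEquivalence (equiv {X} {Y})
  module HomReasoning {X Y : Obj} = SetoidReasoning (homSetoid X Y)

  record IsIso {X Y : Obj} (f : X ⇒ Y) : Set (ℓ ⊔ e) where
    field
      inv  : Y ⇒ X
      isoˡ : inv ∘ f ≈ id
      isoʳ : f ∘ inv ≈ id

module _ {o ℓ e : Level} (C : Category o ℓ e) where
  open Category C

  record RawSkewMonoidal : Set (o ⊔ ℓ) where
    infixr 10 _⊗₀_ _⊗₁_
    field
      unit       : Obj
      _⊗₀_       : Obj → Obj → Obj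
      _⊗₁_       : ∀ {X X′ Y Y′} → X ⇒ X′ → Y ⇒ Y′ → (X ⊗₀ Y) ⇒ (X′ ⊗₀ Y′)
      unitorˡ    : ∀ X → (unit ⊗₀ X) ⇒ X
      unitorʳ    : ∀ X → X ⇒ (X ⊗₀ unit)
      associator : ∀ X Y Z → ((X ⊗₀ Y) ⊗₀ Z) ⇒ (X ⊗₀ (Y ⊗₀ Z))

module _ {o ℓ e : Level} {C : Category o ℓ e} (V : RawSkewMonoidal C) where
  open Category C
  open RawSkewMonoidal V

  record IsLeftSkewMonoidal : Set (o ⊔ ℓ ⊔ e) where
    field
      ⊗-resp-≈ : ∀ {X X′ Y Y′} {f g : X ⇒ X′} {h i : Y ⇒ Y′} →
                 f ≈ g → h ≈ i → f ⊗₁ h ≈ g ⊗₁ i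
      ⊗-id     : ∀ {X Y} → id {X} ⊗₁ id {Y} ≈ id
      ⊗-∘      : ∀ {X X′ X″ Y Y′ Y″}
                 {f : X ⇒ X′} {f′ : X′ ⇒ X″} {g : Y ⇒ Y′} {g′ : Y′ ⇒ Y″} →
                 (f′ ∘ f) ⊗₁ (g′ ∘ g) ≈ (f′ ⊗₁ g′) ∘ (f ⊗₁ g)

      unitorˡ-natural    : ∀ {X Y} (f : X ⇒ Y) →
                           unitorˡ Y ∘ (id ⊗₁ f) ≈ f ∘ unitorˡ X
      unitorʳ-natural    : ∀ {X Y} (f : X ⇒ Y) →
                           unitorʳ Y ∘ f ≈ (f ⊗₁ id) ∘ unitorʳ X
      associator-natural : ∀ {X X′ Y Y′ Z Z′} (f : X ⇒ X′) (g : Y ⇒ Y′) (h : Z ⇒ Z′) →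
                           associator X′ Y′ Z′ ∘ ((f ⊗₁ g) ⊗₁ h)
                             ≈ (f ⊗₁ (g ⊗₁ h)) ∘ associator X Y Z

      unit-unit   : unitorˡ unit ∘ unitorʳ unit ≈ id
      unit-middle : ∀ X Y →
                    (id ⊗₁ unitorˡ Y) ∘ associator X unit Y ∘ (unitorʳ X ⊗₁ id)
                      ≈ id {X ⊗₀ Y}
      unit-left   : ∀ X Y →
                    unitorˡ (X ⊗₀ Y) ∘ associator unit X Y ≈ unitorˡ X ⊗₁ id {Y}
      unit-right  : ∀ X Y →
                    associator X Y unit ∘ unitorʳ (X ⊗₀ Y) ≈ id {X} ⊗₁ unitorʳ Y
      pentagon    : ∀ X Y Z W →
                    (id {X} ⊗₁ associator Y Z W) ∘ associator X (Y ⊗₀ Z) W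
                        ∘ (associator X Y Z ⊗₁ id {W})
                      ≈ associator X Y (Z ⊗₀ W) ∘ associator (X ⊗₀ Y) Z W

  IsLeftNormal : Set (o ⊔ ℓ ⊔ e)
  IsLeftNormal = ∀ X → IsIso (unitorˡ X)

  record IsMonoidal : Set (o ⊔ ℓ ⊔ e) where
    field
      isLeftSkewMonoidal : IsLeftSkewMonoidal
      unitorˡ-iso        : IsLeftNormal
      unitorʳ-iso        : ∀ X → IsIso (unitorʳ X)
      associator-iso     : ∀ X Y Z → IsIso (associator X Y Z)

record LeftSkewMonoidal {o ℓ e : Level} (C : Category o ℓ e) : Set (o ⊔ ℓ ⊔ e) where
  field
    raw                : RawSkewMonoidal C
    isLeftSkewMonoidal : IsLeftSkewMonoidal raw
  open RawSkewMonoidal raw public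
  open IsLeftSkewMonoidal isLeftSkewMonoidal public

record MonoidIn {o ℓ e : Level} {C : Category o ℓ e} (V : LeftSkewMonoidal C)
                : Set (o ⊔ ℓ ⊔ e) where
  open Category C
  open LeftSkewMonoidal V
  field
    T   : Obj
    η   : unit ⇒ T
    μ   : (T ⊗₀ T) ⇒ T
    μ-unitˡ : μ ∘ (η ⊗₁ id) ≈ unitorˡ T
    μ-unitʳ : μ ∘ (id ⊗₁ η) ∘ unitorʳ T ≈ id
    μ-assoc : μ ∘ (μ ⊗₁ id) ≈ μ ∘ (id ⊗₁ μ) ∘ associator T T T

module _ {o ℓ e : Level} (C : Category o ℓ e) where
  open Category C

  MorphismClass : ∀ p → Set (o ⊔ ℓ ⊔ suc p)
  MorphismClass p = ∀ {X Y} → X ⇒ Y → Set p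

module _ {o ℓ e : Level} {C : Category o ℓ e} where
  open Category C

  record Diagonal {A B X Y : Obj} (u : A ⇒ B) (f : A ⇒ X) (g : B ⇒ Y) (v : X ⇒ Y)
                  : Set (ℓ ⊔ e) where
    field
      diagonal : B ⇒ X
      upper    : diagonal ∘ u ≈ f
      lower    : v ∘ diagonal ≈ g
      unique   : ∀ {d : B ⇒ X} → d ∘ u ≈ f → v ∘ d ≈ g → d ≈ diagonal

  record Factorization {p q : Level} (E : MorphismClass C p) (M : MorphismClass C q)
                       {X Y : Obj} (h : X ⇒ Y) : Set (o ⊔ ℓ ⊔ e ⊔ p ⊔ q) where
    field
      image    : Obj
      left     : X ⇒ image
      right    : image ⇒ Y
      left∈E   : E left
      right∈M  : M right
      factors  : h ≈ right ∘ left

record OrthogonalFactorizationSystem {o ℓ e : Level} (C : Category o ℓ e) (p q : Level)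
                                     : Set (o ⊔ ℓ ⊔ e ⊔ suc (p ⊔ q)) where
  open Category C
  field
    E : MorphismClass C p
    M : MorphismClass C q

    -- A class of morphisms must respect the equality of the hom-setoids.
    E-resp-≈ : ∀ {X Y} {f g : X ⇒ Y} → f ≈ g → E f → E g
    M-resp-≈ : ∀ {X Y} {f g : X ⇒ Y} → f ≈ g → M f → M g

    iso⇒E : ∀ {X Y} {f : X ⇒ Y} → IsIso f → E f
    iso⇒M : ∀ {X Y} {f : X ⇒ Y} → IsIso f → M f
    E-∘   : ∀ {X Y Z} {g : Y ⇒ Z} {f : X ⇒ Y} → E g → E f → E (g ∘ f)
    M-∘   : ∀ {X Y Z} {g : Y ⇒ Z} {f : X ⇒ Y} → M g → M f → M (g ∘ f)

    orthogonal : ∀ {A B X Y} {u : A ⇒ B} {f : A ⇒ X} {g : B ⇒ Y} {v : X ⇒ Y} →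
                 E u → M v → g ∘ u ≈ v ∘ f → Diagonal {C = C} u f g v
    factor     : ∀ {X Y} (h : X ⇒ Y) → Factorization {C = C} E M h

module MSlice {o ℓ e p q : Level} {C : Category o ℓ e}
              (F : OrthogonalFactorizationSystem C p q) (T : Category.Obj C) where
  open Category C
  open OrthogonalFactorizationSystem F

  record SliceObj : Set (o ⊔ ℓ ⊔ q) where
    constructor sliceObj
    field
      {dom} : Obj
      arr   : dom ⇒ T
      arr∈M : M arr
  open SliceObj public

  record SliceHom (S S′ : SliceObj) : Set (ℓ ⊔ e) where
    constructor sliceHom
    field
      hom      : dom S ⇒ dom S′
      commutes : arr S′ ∘ hom ≈ arr S
  open SliceHom public

  M/ : Category (o ⊔ ℓ ⊔ q) (ℓ ⊔ e) e
  M/ = record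
    { Obj = SliceObj
    ; _⇒_ = SliceHom
    ; _≈_ = λ f g → hom f ≈ hom g
    ; id = sliceHom id identityʳ
    ; _∘_ = λ g f → sliceHom (hom g ∘ hom f)
        (Equiv.trans (Equiv.sym assoc)
          (Equiv.trans (∘-resp-≈ (commutes g) Equiv.refl) (commutes f)))
    ; equiv = record { refl = Equiv.refl ; sym = Equiv.sym ; trans = Equiv.trans }
    ; ∘-resp-≈ = ∘-resp-≈
    ; identityˡ = identityˡ
    ; identityʳ = identityʳ
    ; assoc = assoc
    }

module _ {o ℓ e p q : Level} {C : Category o ℓ e} (V : LeftSkewMonoidal C)
         (𝕋 : MonoidIn V) (F : OrthogonalFactorizationSystem C p q) where
  open Category C
  open LeftSkewMonoidal V
  open MonoidIn 𝕋
  open OrthogonalFactorizationSystem F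
  open MSlice F T

  ClosedUnder-⊗S : Set (o ⊔ ℓ ⊔ p ⊔ q)
  ClosedUnder-⊗S = ∀ (S : SliceObj) {X Y} {u : X ⇒ Y} → E u → E (u ⊗₁ id {dom S})

  ClosedUnder-S⊗ : Set (o ⊔ ℓ ⊔ p ⊔ q)
  ClosedUnder-S⊗ = ∀ (S : SliceObj) {X Y} {u : X ⇒ Y} → E u → E (id {dom S} ⊗₁ u)

  -- A choice of the factorizations defining J and ⊠.  It is arbitrary: it need
  -- not be the one recorded in F, which shows that a choice exists.
  record ChosenFactorizations : Set (o ⊔ ℓ ⊔ e ⊔ p ⊔ q) where
    field
      factor-η : Factorization {C = C} E M η
      factor-μ : ∀ (S S′ : SliceObj) → Factorization {C = C} E M (μ ∘ (arr S ⊗₁ arr S′))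

module SliceStructure {o ℓ e p q : Level} {C : Category o ℓ e} {V : LeftSkewMonoidal C}
                      (𝕋 : MonoidIn V) (F : OrthogonalFactorizationSystem C p q)
                      (closed : ClosedUnder-⊗S V 𝕋 F)
                      (choice : ChosenFactorizations V 𝕋 F) where
  open Category C
  open LeftSkewMonoidal V
  open MonoidIn 𝕋
  open OrthogonalFactorizationSystem F
  open MSlice F T
  open ChosenFactorizations choice
  open Factorization
  open Diagonal
  open HomReasoning
  open Equiv using (refl; sym; trans)

  private
    infixr 4 _⟩∘⟨_
    _⟩∘⟨_ : ∀ {X Y Z} {f g : Y ⇒ Z} {h i : X ⇒ Y} → f ≈ g → h ≈ i → f ∘ h ≈ g ∘ i
    _⟩∘⟨_ = ∘-resp-≈

    pullˡ : ∀ {W X Y Z} {f : Y ⇒ Z} {g : X ⇒ Y} {h : X ⇒ Z} {k : W ⇒ X} →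
            f ∘ g ≈ h → f ∘ g ∘ k ≈ h ∘ k
    pullˡ eq = trans (sym assoc) (eq ⟩∘⟨ refl)

    ⊗-merge : ∀ {X X′ X″ Y Y′ Y″}
              {f : X ⇒ X′} {f′ : X′ ⇒ X″} {g : Y ⇒ Y′} {g′ : Y′ ⇒ Y″}
              {h : X ⇒ X″} {k : Y ⇒ Y″} →
              f′ ∘ f ≈ h → g′ ∘ g ≈ k → (f′ ⊗₁ g′) ∘ (f ⊗₁ g) ≈ h ⊗₁ k
    ⊗-merge p q = trans (sym ⊗-∘) (⊗-resp-≈ p q)

  J : SliceObj
  J = sliceObj (right factor-η) (right∈M factor-η)

  q-unit : unit ⇒ dom J
  q-unit = left factor-η

  infixr 10 _⊠_
  _⊠_ : SliceObj → SliceObj → SliceObj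
  S ⊠ S′ = sliceObj (right (factor-μ S S′)) (right∈M (factor-μ S S′))

  q-tensor : ∀ S S′ → (dom S ⊗₀ dom S′) ⇒ dom (S ⊠ S′)
  q-tensor S S′ = left (factor-μ S S′)

  private
    q-tensor-factors : ∀ S S′ → arr (S ⊠ S′) ∘ q-tensor S S′ ≈ μ ∘ (arr S ⊗₁ arr S′)
    q-tensor-factors S S′ = sym (factors (factor-μ S S′))

    ⊠-square : ∀ {S₁ S₂ S₁′ S₂′} (f : SliceHom S₁ S₂) (f′ : SliceHom S₁′ S₂′) →
               arr (S₁ ⊠ S₁′) ∘ q-tensor S₁ S₁′
                 ≈ arr (S₂ ⊠ S₂′) ∘ q-tensor S₂ S₂′ ∘ (hom f ⊗₁ hom f′)
    ⊠-square {S₁} {S₂} {S₁′} {S₂′} f f′ = begin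
      arr (S₁ ⊠ S₁′) ∘ q-tensor S₁ S₁′
        ≈⟨ q-tensor-factors S₁ S₁′ ⟩
      μ ∘ (arr S₁ ⊗₁ arr S₁′)
        ≈⟨ refl ⟩∘⟨ ⊗-merge (commutes f) (commutes f′) ⟨
      μ ∘ (arr S₂ ⊗₁ arr S₂′) ∘ (hom f ⊗₁ hom f′)
        ≈⟨ assoc ⟨
      (μ ∘ (arr S₂ ⊗₁ arr S₂′)) ∘ (hom f ⊗₁ hom f′)
        ≈⟨ pullˡ (q-tensor-factors S₂ S₂′) ⟨
      arr (S₂ ⊠ S₂′) ∘ q-tensor S₂ S₂′ ∘ (hom f ⊗₁ hom f′) ∎

    ℓ-square : ∀ S → arr (J ⊠ S) ∘ q-tensor J S ∘ (q-unit ⊗₁ id)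
                       ≈ arr S ∘ unitorˡ (dom S)
    ℓ-square S = begin
      arr (J ⊠ S) ∘ q-tensor J S ∘ (q-unit ⊗₁ id)
        ≈⟨ pullˡ (q-tensor-factors J S) ⟩
      (μ ∘ (arr J ⊗₁ arr S)) ∘ (q-unit ⊗₁ id)
        ≈⟨ assoc ⟩
      μ ∘ (arr J ⊗₁ arr S) ∘ (q-unit ⊗₁ id)
        ≈⟨ refl ⟩∘⟨ ⊗-merge (sym (factors factor-η)) identityʳ ⟩
      μ ∘ (η ⊗₁ arr S)
        ≈⟨ refl ⟩∘⟨ ⊗-merge identityʳ identityˡ ⟨
      μ ∘ (η ⊗₁ id) ∘ (id ⊗₁ arr S)
        ≈⟨ pullˡ μ-unitˡ ⟩
      unitorˡ T ∘ (id ⊗₁ arr S)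
        ≈⟨ unitorˡ-natural (arr S) ⟩
      arr S ∘ unitorˡ (dom S) ∎

    r-commutes : ∀ S → arr (S ⊠ J) ∘ q-tensor S J ∘ (id ⊗₁ q-unit) ∘ unitorʳ (dom S)
                         ≈ arr S
    r-commutes S = begin
      arr (S ⊠ J) ∘ q-tensor S J ∘ (id ⊗₁ q-unit) ∘ unitorʳ (dom S)
        ≈⟨ pullˡ (q-tensor-factors S J) ⟩
      (μ ∘ (arr S ⊗₁ arr J)) ∘ (id ⊗₁ q-unit) ∘ unitorʳ (dom S)
        ≈⟨ assoc ⟩
      μ ∘ (arr S ⊗₁ arr J) ∘ (id ⊗₁ q-unit) ∘ unitorʳ (dom S)
        ≈⟨ refl ⟩∘⟨ pullˡ (⊗-merge identityʳ (sym (factors factor-η))) ⟩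
      μ ∘ (arr S ⊗₁ η) ∘ unitorʳ (dom S)
        ≈⟨ refl ⟩∘⟨ pullˡ (⊗-merge identityˡ identityʳ) ⟨
      μ ∘ (id ⊗₁ η) ∘ (arr S ⊗₁ id) ∘ unitorʳ (dom S)
        ≈⟨ refl ⟩∘⟨ refl ⟩∘⟨ unitorʳ-natural (arr S) ⟨
      μ ∘ (id ⊗₁ η) ∘ unitorʳ T ∘ arr S
        ≈⟨ refl ⟩∘⟨ assoc ⟨
      μ ∘ ((id ⊗₁ η) ∘ unitorʳ T) ∘ arr S
        ≈⟨ pullˡ μ-unitʳ ⟩
      id ∘ arr S
        ≈⟨ identityˡ ⟩
      arr S ∎

    a-square : ∀ S S′ S″ →
               arr ((S ⊠ S′) ⊠ S″) ∘ q-tensor (S ⊠ S′) S″ ∘ (q-tensor S S′ ⊗₁ id)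
                 ≈ arr (S ⊠ (S′ ⊠ S″))
                     ∘ q-tensor S (S′ ⊠ S″) ∘ (id ⊗₁ q-tensor S′ S″)
                     ∘ associator (dom S) (dom S′) (dom S″)
    a-square S S′ S″ = begin
      arr ((S ⊠ S′) ⊠ S″) ∘ q-tensor (S ⊠ S′) S″ ∘ (q-tensor S S′ ⊗₁ id)
        ≈⟨ pullˡ (q-tensor-factors (S ⊠ S′) S″) ⟩
      (μ ∘ (arr (S ⊠ S′) ⊗₁ arr S″)) ∘ (q-tensor S S′ ⊗₁ id)
        ≈⟨ assoc ⟩
      μ ∘ (arr (S ⊠ S′) ⊗₁ arr S″) ∘ (q-tensor S S′ ⊗₁ id)
        ≈⟨ refl ⟩∘⟨ ⊗-merge (q-tensor-factors S S′) identityʳ ⟩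
      μ ∘ ((μ ∘ (s ⊗₁ s′)) ⊗₁ s″)
        ≈⟨ refl ⟩∘⟨ ⊗-merge refl identityˡ ⟨
      μ ∘ (μ ⊗₁ id) ∘ ((s ⊗₁ s′) ⊗₁ s″)
        ≈⟨ pullˡ μ-assoc ⟩
      (μ ∘ (id ⊗₁ μ) ∘ associator T T T) ∘ ((s ⊗₁ s′) ⊗₁ s″)
        ≈⟨ trans assoc (refl ⟩∘⟨ assoc) ⟩
      μ ∘ (id ⊗₁ μ) ∘ associator T T T ∘ ((s ⊗₁ s′) ⊗₁ s″)
        ≈⟨ refl ⟩∘⟨ refl ⟩∘⟨ associator-natural s s′ s″ ⟩
      μ ∘ (id ⊗₁ μ) ∘ (s ⊗₁ (s′ ⊗₁ s″)) ∘ α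
        ≈⟨ refl ⟩∘⟨ pullˡ (⊗-merge identityˡ refl) ⟩
      μ ∘ (s ⊗₁ (μ ∘ (s′ ⊗₁ s″))) ∘ α
        ≈⟨ refl ⟩∘⟨ pullˡ (⊗-merge identityʳ (q-tensor-factors S′ S″)) ⟨
      μ ∘ (s ⊗₁ arr (S′ ⊠ S″)) ∘ (id ⊗₁ q-tensor S′ S″) ∘ α
        ≈⟨ assoc ⟨
      (μ ∘ (s ⊗₁ arr (S′ ⊠ S″))) ∘ (id ⊗₁ q-tensor S′ S″) ∘ α
        ≈⟨ pullˡ (q-tensor-factors S (S′ ⊠ S″)) ⟨
      arr (S ⊠ (S′ ⊠ S″)) ∘ q-tensor S (S′ ⊠ S″) ∘ (id ⊗₁ q-tensor S′ S″) ∘ α ∎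
      where
        s  = arr S
        s′ = arr S′
        s″ = arr S″
        α  = associator (dom S) (dom S′) (dom S″)

  ⊠-diagonal : ∀ {S₁ S₂ S₁′ S₂′} (f : SliceHom S₁ S₂) (f′ : SliceHom S₁′ S₂′) →
               Diagonal {C = C} (q-tensor S₁ S₁′)
                                (q-tensor S₂ S₂′ ∘ (hom f ⊗₁ hom f′))
                                (arr (S₁ ⊠ S₁′))
                                (arr (S₂ ⊠ S₂′))
  ⊠-diagonal {S₁} {S₂} {S₁′} {S₂′} f f′ =
    orthogonal (left∈E (factor-μ S₁ S₁′)) (arr∈M (S₂ ⊠ S₂′)) (⊠-square f f′)

  ℓ-diagonal : ∀ S →
               Diagonal {C = C} (q-tensor J S ∘ (q-unit ⊗₁ id))
                                (unitorˡ (dom S))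
                                (arr (J ⊠ S))
                                (arr S)
  ℓ-diagonal S =
    orthogonal (E-∘ (left∈E (factor-μ J S)) (closed S (left∈E factor-η)))
               (arr∈M S)
               (ℓ-square S)

  a-diagonal : ∀ S S′ S″ →
               Diagonal {C = C} (q-tensor (S ⊠ S′) S″ ∘ (q-tensor S S′ ⊗₁ id))
                                (q-tensor S (S′ ⊠ S″) ∘ (id ⊗₁ q-tensor S′ S″)
                                   ∘ associator (dom S) (dom S′) (dom S″))
                                (arr ((S ⊠ S′) ⊠ S″))
                                (arr (S ⊠ (S′ ⊠ S″)))
  a-diagonal S S′ S″ =
    orthogonal (E-∘ (left∈E (factor-μ (S ⊠ S′) S″)) (closed S″ (left∈E (factor-μ S S′))))
               (arr∈M (S ⊠ (S′ ⊠ S″)))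
               (a-square S S′ S″)

  private
    fromDiagonal : ∀ {A S S′} {u : A ⇒ dom S} {f : A ⇒ dom S′} →
                   Diagonal {C = C} u f (arr S) (arr S′) → SliceHom S S′
    fromDiagonal d = sliceHom (diagonal d) (lower d)

  sliceRaw : RawSkewMonoidal M/
  sliceRaw = record
    { unit       = J
    ; _⊗₀_       = _⊠_
    ; _⊗₁_       = λ {S₁} {S₂} {S₁′} {S₂′} f f′ →
                     fromDiagonal {S = S₁ ⊠ S₁′} {S′ = S₂ ⊠ S₂′} (⊠-diagonal f f′)
    ; unitorˡ    = λ S → fromDiagonal {S = J ⊠ S} {S′ = S} (ℓ-diagonal S)
    ; unitorʳ    = λ S → sliceHom
                     (q-tensor S J ∘ (id ⊗₁ q-unit) ∘ unitorʳ (dom S))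
                     (r-commutes S)
    ; associator = λ S S′ S″ →
                     fromDiagonal {S = (S ⊠ S′) ⊠ S″} {S′ = S ⊠ (S′ ⊠ S″)}
                                  (a-diagonal S S′ S″)
    }

{-# OPTIONS --safe #-}
-- A morphism of M/T out of the codomain of an E-map is determined by its
-- composite with that map.  Hence every axiom for ⊠ may be checked after
-- precomposition with the maps q, where the defining triangles of ⊠, ℓ, r and a
-- turn it into the corresponding axiom for ⊗.  In the same way a morphism g of
-- M/T is invertible as soon as u and g ∘ u lie in E for some u.
module Submission where

open import Defs
open import Data.Product using (_×_; _,_)
open import Level using (Level)

-- Rewriting inside right-nested composites.

module Composition {o ℓ e : Level} (C : Category o ℓ e) where
  open Category C
  open Equiv using (refl; sym; trans)

  infixr 4 _⟩∘⟨_ refl⟩∘⟨_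
  infixl 5 _⟩∘⟨refl
  _⟩∘⟨_ : ∀ {X Y Z} {f g : Y ⇒ Z} {h i : X ⇒ Y} → f ≈ g → h ≈ i → f ∘ h ≈ g ∘ i
  _⟩∘⟨_ = ∘-resp-≈

  refl⟩∘⟨_ : ∀ {X Y Z} {f : Y ⇒ Z} {h i : X ⇒ Y} → h ≈ i → f ∘ h ≈ f ∘ i
  refl⟩∘⟨ eq = refl ⟩∘⟨ eq

  _⟩∘⟨refl : ∀ {X Y Z} {f g : Y ⇒ Z} {h : X ⇒ Y} → f ≈ g → f ∘ h ≈ g ∘ h
  eq ⟩∘⟨refl = eq ⟩∘⟨ refl

  pullˡ : ∀ {W X Y Z} {f : Y ⇒ Z} {g : X ⇒ Y} {h : X ⇒ Z} {k : W ⇒ X} →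
          f ∘ g ≈ h → f ∘ g ∘ k ≈ h ∘ k
  pullˡ eq = trans (sym assoc) (eq ⟩∘⟨refl)

  pullˡ₃ : ∀ {V W X Y Z} {f : Y ⇒ Z} {g : X ⇒ Y} {h : W ⇒ X} {i : W ⇒ Z} {k : V ⇒ W} →
           f ∘ g ∘ h ≈ i → f ∘ g ∘ h ∘ k ≈ i ∘ k
  pullˡ₃ eq = trans (refl⟩∘⟨ sym assoc) (pullˡ eq)

  extendʳ : ∀ {W X Y Y′ Z} {f : Y ⇒ Z} {g : X ⇒ Y} {f′ : Y′ ⇒ Z} {g′ : X ⇒ Y′}
            {k : W ⇒ X} → f ∘ g ≈ f′ ∘ g′ → f ∘ g ∘ k ≈ f′ ∘ g′ ∘ k
  extendʳ eq = trans (pullˡ eq) assoc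

  -- The pattern has three factors on each side because the defining triangle `a-q` of the
  -- associator does; it is rewritten in the middle of longer composites.
  extendʳ₃ : ∀ {V W X X′ Y Y′ Z} {f : Y ⇒ Z} {g : X ⇒ Y} {h : W ⇒ X}
             {f′ : Y′ ⇒ Z} {g′ : X′ ⇒ Y′} {h′ : W ⇒ X′} {k : V ⇒ W} →
             f ∘ g ∘ h ≈ f′ ∘ g′ ∘ h′ → f ∘ g ∘ h ∘ k ≈ f′ ∘ g′ ∘ h′ ∘ k
  extendʳ₃ eq = trans (pullˡ₃ eq) (trans assoc (refl⟩∘⟨ assoc))

  id-isIso : ∀ {X} → IsIso (id {X})
  id-isIso = record { inv = id ; isoˡ = identityˡ ; isoʳ = identityˡ }

-- Bifunctoriality of the tensor and one-variable naturality of the associator.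

module SkewTensor {o ℓ e : Level} {C : Category o ℓ e} (V : LeftSkewMonoidal C) where
  open Category C
  open LeftSkewMonoidal V
  open Composition C
  open Equiv using (refl; sym; trans)

  ⊗-merge : ∀ {X X′ X″ Y Y′ Y″}
            {f : X ⇒ X′} {f′ : X′ ⇒ X″} {g : Y ⇒ Y′} {g′ : Y′ ⇒ Y″}
            {h : X ⇒ X″} {k : Y ⇒ Y″} →
            f′ ∘ f ≈ h → g′ ∘ g ≈ k → (f′ ⊗₁ g′) ∘ (f ⊗₁ g) ≈ h ⊗₁ k
  ⊗-merge p q = trans (sym ⊗-∘) (⊗-resp-≈ p q)

  ⊗-mergeˡ : ∀ {X X′ X″ Y} {f : X ⇒ X′} {g : X′ ⇒ X″} {h : X ⇒ X″} →
             g ∘ f ≈ h → (g ⊗₁ id {Y}) ∘ (f ⊗₁ id) ≈ h ⊗₁ id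
  ⊗-mergeˡ eq = ⊗-merge eq identityˡ

  ⊗-mergeʳ : ∀ {X Y Y′ Y″} {f : Y ⇒ Y′} {g : Y′ ⇒ Y″} {h : Y ⇒ Y″} →
             g ∘ f ≈ h → (id {X} ⊗₁ g) ∘ (id ⊗₁ f) ≈ id ⊗₁ h
  ⊗-mergeʳ eq = ⊗-merge identityˡ eq

  ⊗-square : ∀ {X X₁ X₂ X′ Y Y₁ Y₂ Y′}
             {f₁ : X ⇒ X₁} {g₁ : X₁ ⇒ X′} {f₂ : X ⇒ X₂} {g₂ : X₂ ⇒ X′}
             {h₁ : Y ⇒ Y₁} {k₁ : Y₁ ⇒ Y′} {h₂ : Y ⇒ Y₂} {k₂ : Y₂ ⇒ Y′} →
             g₁ ∘ f₁ ≈ g₂ ∘ f₂ → k₁ ∘ h₁ ≈ k₂ ∘ h₂ →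
             (g₁ ⊗₁ k₁) ∘ (f₁ ⊗₁ h₁) ≈ (g₂ ⊗₁ k₂) ∘ (f₂ ⊗₁ h₂)
  ⊗-square p q = trans (⊗-merge p q) ⊗-∘

  id-commutes : ∀ {X Y} {f : X ⇒ Y} → id ∘ f ≈ f ∘ id
  id-commutes = trans identityˡ (sym identityʳ)

  -- Both sides are `f ⊗₁ g`. This brings a map acting on one factor next to the `q-tensor` whose
  -- defining triangle it completes.
  ⊗-interchange : ∀ {X X′ Y Y′} {f : X ⇒ X′} {g : Y ⇒ Y′} →
                  (id ⊗₁ g) ∘ (f ⊗₁ id) ≈ (f ⊗₁ id) ∘ (id ⊗₁ g)
  ⊗-interchange = ⊗-square id-commutes (sym id-commutes)

  associator-naturalˡ : ∀ {X X′ Y Z} (f : X ⇒ X′) →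
    associator X′ Y Z ∘ ((f ⊗₁ id) ⊗₁ id) ≈ (f ⊗₁ id) ∘ associator X Y Z
  associator-naturalˡ f =
    trans (associator-natural f id id) (⊗-resp-≈ refl ⊗-id ⟩∘⟨refl)

  associator-naturalʳ : ∀ {X Y Z Z′} (h : Z ⇒ Z′) →
    associator X Y Z′ ∘ (id ⊗₁ h) ≈ (id ⊗₁ (id ⊗₁ h)) ∘ associator X Y Z
  associator-naturalʳ h =
    trans (refl⟩∘⟨ ⊗-resp-≈ (sym ⊗-id) refl) (associator-natural id id h)

-- Cancelling E-maps and detecting isomorphisms in M/T.

module SliceLifting {o ℓ e p q : Level} {C : Category o ℓ e}
                    (F : OrthogonalFactorizationSystem C p q) (T : Category.Obj C) where
  open Category C
  open OrthogonalFactorizationSystem F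
  open MSlice F T
  open Composition C
  open Equiv using (sym; trans)

  -- Both morphisms are diagonals of one square, with `u` on the left, `arr S′` on the right,
  -- `hom d′ ∘ u` on top and `arr S` at the bottom, so uniqueness identifies them.
  E-cancel : ∀ {A S S′} (d d′ : SliceHom S S′) {u : A ⇒ dom S} → E u →
             hom d ∘ u ≈ hom d′ ∘ u → hom d ≈ hom d′
  E-cancel {S′ = S′} d d′ {u} u∈E eq =
    trans (unique eq (commutes d)) (sym (unique Equiv.refl (commutes d′)))
    where open Diagonal (orthogonal u∈E (arr∈M S′)
                           (trans (sym (commutes d′) ⟩∘⟨refl) assoc))

  -- The inverse is the diagonal of `hom g ∘ u` against `arr S` with top side `u`; its lower
  -- triangle makes it a morphism of M/T. The two inverse laws follow by cancelling `u` and
  -- `hom g ∘ u` respectively.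
  E-iso : ∀ {A S S′} (g : SliceHom S S′) {u : A ⇒ dom S} → E u → E (hom g ∘ u) →
          Category.IsIso M/ g
  E-iso {S = S} {S′} g {u} u∈E gu∈E = record
    { inv  = g⁻¹
    ; isoˡ = E-cancel (g⁻¹ ∘ₛ g) idₛ u∈E
               (trans assoc (trans upper (sym identityˡ)))
    ; isoʳ = E-cancel (g ∘ₛ g⁻¹) idₛ gu∈E
               (trans assoc (trans (refl⟩∘⟨ upper) (sym identityˡ)))
    }
    where
      open Category M/ using () renaming (_∘_ to _∘ₛ_; id to idₛ)
      open Diagonal (orthogonal gu∈E (arr∈M S) (pullˡ (commutes g)))
      g⁻¹ : SliceHom S′ S
      g⁻¹ = sliceHom diagonal lower

-- Defining E-maps and triangles of the structure on M/T.

module SliceSkewMonoidal {o ℓ e p q : Level} {C : Category o ℓ e} {V : LeftSkewMonoidal C}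
                         (𝕋 : MonoidIn V) (F : OrthogonalFactorizationSystem C p q)
                         (closed : ClosedUnder-⊗S V 𝕋 F)
                         (choice : ChosenFactorizations V 𝕋 F) where
  open Category C
  open LeftSkewMonoidal V
  open MonoidIn 𝕋 using (T)
  open OrthogonalFactorizationSystem F
  open MSlice F T
  open ChosenFactorizations choice
  open Factorization
  open Diagonal
  open SliceStructure 𝕋 F closed choice
  open HomReasoning
  open Equiv using (refl; sym; trans)
  open Composition C
  open SkewTensor V
  open SliceLifting F T
  open Category M/ using () renaming (_∘_ to _∘ₛ_)
  open RawSkewMonoidal sliceRaw using ()
    renaming (_⊗₁_ to infixr 10 _⊠₁_; unitorˡ to ℓₛ; unitorʳ to rₛ; associator to aₛ)

  -- The object is explicit because `hom (idₛ S)` reduces to `id`, from which `arr S` cannot be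
  -- recovered.
  idₛ : ∀ S → SliceHom S S
  idₛ S = Category.id M/ {S}

  q-tensor∈E : ∀ S S′ → E (q-tensor S S′)
  q-tensor∈E S S′ = left∈E (factor-μ S S′)

  q-unit∈E : E q-unit
  q-unit∈E = left∈E factor-η

  qₗ : ∀ S → (unit ⊗₀ dom S) ⇒ dom (J ⊠ S)
  qₗ S = q-tensor J S ∘ (q-unit ⊗₁ id)

  q₃ : ∀ S S′ S″ → ((dom S ⊗₀ dom S′) ⊗₀ dom S″) ⇒ dom ((S ⊠ S′) ⊠ S″)
  q₃ S S′ S″ = q-tensor (S ⊠ S′) S″ ∘ (q-tensor S S′ ⊗₁ id)

  -- Closure of E under tensoring on the right enters here, for `q-unit ⊗₁ id`; in `q₃∈E` it is
  -- applied to `q-tensor S S′ ⊗₁ id`.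
  qₗ∈E : ∀ S → E (qₗ S)
  qₗ∈E S = E-∘ (q-tensor∈E J S) (closed S q-unit∈E)

  q₃∈E : ∀ S S′ S″ → E (q₃ S S′ S″)
  q₃∈E S S′ S″ = E-∘ (q-tensor∈E (S ⊠ S′) S″) (closed S″ (q-tensor∈E S S′))

  -- The upper triangles `⊠-q`, `ℓ-q` and `a-q` serve as rewriting rules that move structure maps
  -- past the maps q. The right unitor is an explicit composite and unfolds by definition.
  ⊠-q : ∀ {S₁ S₂ S₁′ S₂′} (f : SliceHom S₁ S₂) (f′ : SliceHom S₁′ S₂′) →
        hom (f ⊠₁ f′) ∘ q-tensor S₁ S₁′ ≈ q-tensor S₂ S₂′ ∘ (hom f ⊗₁ hom f′)
  ⊠-q f f′ = upper (⊠-diagonal f f′)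

  ℓ-q : ∀ S → hom (ℓₛ S) ∘ q-tensor J S ∘ (q-unit ⊗₁ id) ≈ unitorˡ (dom S)
  ℓ-q S = upper (ℓ-diagonal S)

  a-q : ∀ S S′ S″ →
        hom (aₛ S S′ S″) ∘ q-tensor (S ⊠ S′) S″ ∘ (q-tensor S S′ ⊗₁ id)
          ≈ q-tensor S (S′ ⊠ S″) ∘ (id ⊗₁ q-tensor S′ S″)
              ∘ associator (dom S) (dom S′) (dom S″)
  a-q S S′ S″ = upper (a-diagonal S S′ S″)

  -- Functoriality of the tensor on M/T.

  ⊠-resp-≈ : ∀ {S₁ S₂ S₁′ S₂′} (f g : SliceHom S₁ S₂) (f′ g′ : SliceHom S₁′ S₂′) →
             hom f ≈ hom g → hom f′ ≈ hom g′ → hom (f ⊠₁ f′) ≈ hom (g ⊠₁ g′)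
  ⊠-resp-≈ {S₁} {S₂} {S₁′} {S₂′} f g f′ g′ eq eq′ =
    E-cancel (f ⊠₁ f′) (g ⊠₁ g′) (q-tensor∈E S₁ S₁′) (begin
      hom (f ⊠₁ f′) ∘ q-tensor S₁ S₁′           ≈⟨ ⊠-q f f′ ⟩
      q-tensor S₂ S₂′ ∘ (hom f ⊗₁ hom f′)       ≈⟨ refl⟩∘⟨ ⊗-resp-≈ eq eq′ ⟩
      q-tensor S₂ S₂′ ∘ (hom g ⊗₁ hom g′)       ≈⟨ ⊠-q g g′ ⟨
      hom (g ⊠₁ g′) ∘ q-tensor S₁ S₁′           ∎)

  ⊠-id : ∀ S S′ → hom (idₛ S ⊠₁ idₛ S′) ≈ id
  ⊠-id S S′ = E-cancel (idₛ S ⊠₁ idₛ S′) (idₛ (S ⊠ S′)) (q-tensor∈E S S′) (begin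
    hom (idₛ S ⊠₁ idₛ S′) ∘ q-tensor S S′       ≈⟨ ⊠-q (idₛ S) (idₛ S′) ⟩
    q-tensor S S′ ∘ (id ⊗₁ id)                  ≈⟨ refl⟩∘⟨ ⊗-id ⟩
    q-tensor S S′ ∘ id                          ≈⟨ id-commutes ⟨
    id ∘ q-tensor S S′                          ∎)

  ⊠-∘ : ∀ {S₁ S₂ S₃ S₁′ S₂′ S₃′}
        (f : SliceHom S₁ S₂) (g : SliceHom S₂ S₃)
        (f′ : SliceHom S₁′ S₂′) (g′ : SliceHom S₂′ S₃′) →
        hom ((g ∘ₛ f) ⊠₁ (g′ ∘ₛ f′)) ≈ hom (g ⊠₁ g′) ∘ hom (f ⊠₁ f′)
  ⊠-∘ {S₁} {S₂} {S₃} {S₁′} {S₂′} {S₃′} f g f′ g′ =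
    E-cancel ((g ∘ₛ f) ⊠₁ (g′ ∘ₛ f′)) ((g ⊠₁ g′) ∘ₛ (f ⊠₁ f′)) (q-tensor∈E S₁ S₁′) (begin
      hom ((g ∘ₛ f) ⊠₁ (g′ ∘ₛ f′)) ∘ q-tensor S₁ S₁′
        ≈⟨ ⊠-q (g ∘ₛ f) (g′ ∘ₛ f′) ⟩
      q-tensor S₃ S₃′ ∘ ((hom g ∘ hom f) ⊗₁ (hom g′ ∘ hom f′))
        ≈⟨ refl⟩∘⟨ ⊗-∘ ⟩
      q-tensor S₃ S₃′ ∘ (hom g ⊗₁ hom g′) ∘ (hom f ⊗₁ hom f′)
        ≈⟨ extendʳ (⊠-q g g′) ⟨
      hom (g ⊠₁ g′) ∘ q-tensor S₂ S₂′ ∘ (hom f ⊗₁ hom f′)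
        ≈⟨ refl⟩∘⟨ ⊠-q f f′ ⟨
      hom (g ⊠₁ g′) ∘ hom (f ⊠₁ f′) ∘ q-tensor S₁ S₁′
        ≈⟨ assoc ⟨
      (hom (g ⊠₁ g′) ∘ hom (f ⊠₁ f′)) ∘ q-tensor S₁ S₁′ ∎)

  -- Naturality of the unitors and the associator.

  ℓ-natural : ∀ {S S′} (f : SliceHom S S′) →
              hom (ℓₛ S′) ∘ hom (idₛ J ⊠₁ f) ≈ hom f ∘ hom (ℓₛ S)
  ℓ-natural {S} {S′} f =
    E-cancel (ℓₛ S′ ∘ₛ (idₛ J ⊠₁ f)) (f ∘ₛ ℓₛ S) (qₗ∈E S) (begin
      (hom (ℓₛ S′) ∘ hom (idₛ J ⊠₁ f)) ∘ q-tensor J S ∘ (q-unit ⊗₁ id)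
        ≈⟨ assoc ⟩
      hom (ℓₛ S′) ∘ hom (idₛ J ⊠₁ f) ∘ q-tensor J S ∘ (q-unit ⊗₁ id)
        ≈⟨ refl⟩∘⟨ extendʳ (⊠-q (idₛ J) f) ⟩
      hom (ℓₛ S′) ∘ q-tensor J S′ ∘ (id ⊗₁ hom f) ∘ (q-unit ⊗₁ id)
        -- `q-unit ⊗₁ id` must stand directly after `q-tensor J S′` for `ℓ-q S′` to apply.
        ≈⟨ refl⟩∘⟨ refl⟩∘⟨ ⊗-interchange ⟩
      hom (ℓₛ S′) ∘ q-tensor J S′ ∘ (q-unit ⊗₁ id) ∘ (id ⊗₁ hom f)
        ≈⟨ pullˡ₃ (ℓ-q S′) ⟩
      unitorˡ (dom S′) ∘ (id ⊗₁ hom f)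
        ≈⟨ unitorˡ-natural (hom f) ⟩
      hom f ∘ unitorˡ (dom S)
        ≈⟨ refl⟩∘⟨ ℓ-q S ⟨
      hom f ∘ hom (ℓₛ S) ∘ q-tensor J S ∘ (q-unit ⊗₁ id)
        ≈⟨ assoc ⟨
      (hom f ∘ hom (ℓₛ S)) ∘ q-tensor J S ∘ (q-unit ⊗₁ id) ∎)

  -- No cancellation occurs: `hom (rₛ S)` already has `q-tensor S J` as its last factor, so `⊠-q`
  -- applies to it directly.
  r-natural : ∀ {S S′} (f : SliceHom S S′) →
              hom (rₛ S′) ∘ hom f ≈ hom (f ⊠₁ idₛ J) ∘ hom (rₛ S)
  r-natural {S} {S′} f = begin
    (q-tensor S′ J ∘ (id ⊗₁ q-unit) ∘ unitorʳ (dom S′)) ∘ hom f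
      ≈⟨ trans assoc (refl⟩∘⟨ assoc) ⟩
    q-tensor S′ J ∘ (id ⊗₁ q-unit) ∘ unitorʳ (dom S′) ∘ hom f
      ≈⟨ refl⟩∘⟨ refl⟩∘⟨ unitorʳ-natural (hom f) ⟩
    q-tensor S′ J ∘ (id ⊗₁ q-unit) ∘ (hom f ⊗₁ id) ∘ unitorʳ (dom S)
      ≈⟨ refl⟩∘⟨ extendʳ ⊗-interchange ⟩
    q-tensor S′ J ∘ (hom f ⊗₁ id) ∘ (id ⊗₁ q-unit) ∘ unitorʳ (dom S)
      ≈⟨ extendʳ (⊠-q f (idₛ J)) ⟨
    hom (f ⊠₁ idₛ J) ∘ q-tensor S J ∘ (id ⊗₁ q-unit) ∘ unitorʳ (dom S) ∎

  -- After cancelling `q₃`, the morphisms pass through two layers of q to become a triple tensor in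
  -- C. Naturality of the associator of C rebrackets it, and two backward uses of `⊠-q` rebuild
  -- `f ⊠₁ (g ⊠₁ h)`.
  a-natural : ∀ {S₁ S₂ S₁′ S₂′ S₁″ S₂″}
              (f : SliceHom S₁ S₂) (g : SliceHom S₁′ S₂′) (h : SliceHom S₁″ S₂″) →
              hom (aₛ S₂ S₂′ S₂″) ∘ hom ((f ⊠₁ g) ⊠₁ h)
                ≈ hom (f ⊠₁ (g ⊠₁ h)) ∘ hom (aₛ S₁ S₁′ S₁″)
  a-natural {S₁} {S₂} {S₁′} {S₂′} {S₁″} {S₂″} f g h =
    E-cancel (aₛ S₂ S₂′ S₂″ ∘ₛ ((f ⊠₁ g) ⊠₁ h)) ((f ⊠₁ (g ⊠₁ h)) ∘ₛ aₛ S₁ S₁′ S₁″)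
             (q₃∈E S₁ S₁′ S₁″) (begin
      (hom (aₛ S₂ S₂′ S₂″) ∘ hom ((f ⊠₁ g) ⊠₁ h))
        ∘ q-tensor (S₁ ⊠ S₁′) S₁″ ∘ (q-tensor S₁ S₁′ ⊗₁ id)
        ≈⟨ assoc ⟩
      hom (aₛ S₂ S₂′ S₂″) ∘ hom ((f ⊠₁ g) ⊠₁ h)
        ∘ q-tensor (S₁ ⊠ S₁′) S₁″ ∘ (q-tensor S₁ S₁′ ⊗₁ id)
        ≈⟨ refl⟩∘⟨ extendʳ (⊠-q (f ⊠₁ g) h) ⟩
      hom (aₛ S₂ S₂′ S₂″) ∘ q-tensor (S₂ ⊠ S₂′) S₂″
        ∘ (hom (f ⊠₁ g) ⊗₁ hom h) ∘ (q-tensor S₁ S₁′ ⊗₁ id)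
        ≈⟨ refl⟩∘⟨ refl⟩∘⟨ ⊗-square (⊠-q f g) (sym id-commutes) ⟩
      hom (aₛ S₂ S₂′ S₂″) ∘ q-tensor (S₂ ⊠ S₂′) S₂″
        ∘ (q-tensor S₂ S₂′ ⊗₁ id) ∘ ((hom f ⊗₁ hom g) ⊗₁ hom h)
        ≈⟨ extendʳ₃ (a-q S₂ S₂′ S₂″) ⟩
      q-tensor S₂ (S₂′ ⊠ S₂″) ∘ (id ⊗₁ q-tensor S₂′ S₂″)
        ∘ associator (dom S₂) (dom S₂′) (dom S₂″) ∘ ((hom f ⊗₁ hom g) ⊗₁ hom h)
        ≈⟨ refl⟩∘⟨ refl⟩∘⟨ associator-natural (hom f) (hom g) (hom h) ⟩
      q-tensor S₂ (S₂′ ⊠ S₂″) ∘ (id ⊗₁ q-tensor S₂′ S₂″)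
        ∘ (hom f ⊗₁ (hom g ⊗₁ hom h)) ∘ associator (dom S₁) (dom S₁′) (dom S₁″)
        ≈⟨ refl⟩∘⟨ extendʳ (⊗-square id-commutes (sym (⊠-q g h))) ⟩
      q-tensor S₂ (S₂′ ⊠ S₂″) ∘ (hom f ⊗₁ hom (g ⊠₁ h))
        ∘ (id ⊗₁ q-tensor S₁′ S₁″) ∘ associator (dom S₁) (dom S₁′) (dom S₁″)
        ≈⟨ extendʳ (⊠-q f (g ⊠₁ h)) ⟨
      hom (f ⊠₁ (g ⊠₁ h)) ∘ q-tensor S₁ (S₁′ ⊠ S₁″)
        ∘ (id ⊗₁ q-tensor S₁′ S₁″) ∘ associator (dom S₁) (dom S₁′) (dom S₁″)
        ≈⟨ refl⟩∘⟨ a-q S₁ S₁′ S₁″ ⟨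
      hom (f ⊠₁ (g ⊠₁ h)) ∘ hom (aₛ S₁ S₁′ S₁″)
        ∘ q-tensor (S₁ ⊠ S₁′) S₁″ ∘ (q-tensor S₁ S₁′ ⊗₁ id)
        ≈⟨ assoc ⟨
      (hom (f ⊠₁ (g ⊠₁ h)) ∘ hom (aₛ S₁ S₁′ S₁″))
        ∘ q-tensor (S₁ ⊠ S₁′) S₁″ ∘ (q-tensor S₁ S₁′ ⊗₁ id) ∎)

  -- The five coherence axioms.

  -- The test map is `q-unit`, as the source is `J`. Naturality of the right unitor yields two
  -- copies of `q-unit` on different factors: `ℓ-q J` absorbs one, and naturality of the left unitor
  -- moves the other out, leaving the unit axiom of C.
  ℓ-r-unit : hom (ℓₛ J) ∘ hom (rₛ J) ≈ id
  ℓ-r-unit = E-cancel (ℓₛ J ∘ₛ rₛ J) (idₛ J) q-unit∈E (begin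
    (hom (ℓₛ J) ∘ hom (rₛ J)) ∘ q-unit
      ≈⟨ trans assoc (refl⟩∘⟨ trans assoc (refl⟩∘⟨ assoc)) ⟩
    hom (ℓₛ J) ∘ q-tensor J J ∘ (id ⊗₁ q-unit) ∘ unitorʳ (dom J) ∘ q-unit
      ≈⟨ refl⟩∘⟨ refl⟩∘⟨ refl⟩∘⟨ unitorʳ-natural q-unit ⟩
    hom (ℓₛ J) ∘ q-tensor J J ∘ (id ⊗₁ q-unit) ∘ (q-unit ⊗₁ id) ∘ unitorʳ unit
      ≈⟨ refl⟩∘⟨ refl⟩∘⟨ extendʳ ⊗-interchange ⟩
    hom (ℓₛ J) ∘ q-tensor J J ∘ (q-unit ⊗₁ id) ∘ (id ⊗₁ q-unit) ∘ unitorʳ unit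
      ≈⟨ pullˡ₃ (ℓ-q J) ⟩
    unitorˡ (dom J) ∘ (id ⊗₁ q-unit) ∘ unitorʳ unit
      ≈⟨ extendʳ (unitorˡ-natural q-unit) ⟩
    q-unit ∘ unitorˡ unit ∘ unitorʳ unit
      ≈⟨ refl⟩∘⟨ unit-unit ⟩
    q-unit ∘ id
      ≈⟨ id-commutes ⟨
    id ∘ q-unit ∎)

  ℓ-a-r : ∀ S S′ →
          hom (idₛ S ⊠₁ ℓₛ S′) ∘ hom (aₛ S J S′) ∘ hom (rₛ S ⊠₁ idₛ S′) ≈ id
  ℓ-a-r S S′ =
    E-cancel ((idₛ S ⊠₁ ℓₛ S′) ∘ₛ aₛ S J S′ ∘ₛ (rₛ S ⊠₁ idₛ S′)) (idₛ (S ⊠ S′))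
             (q-tensor∈E S S′) (begin
      (hom (idₛ S ⊠₁ ℓₛ S′) ∘ hom (aₛ S J S′) ∘ hom (rₛ S ⊠₁ idₛ S′)) ∘ q-tensor S S′
        ≈⟨ trans assoc (refl⟩∘⟨ assoc) ⟩
      hom (idₛ S ⊠₁ ℓₛ S′) ∘ hom (aₛ S J S′) ∘ hom (rₛ S ⊠₁ idₛ S′) ∘ q-tensor S S′
        ≈⟨ refl⟩∘⟨ refl⟩∘⟨ ⊠-q (rₛ S) (idₛ S′) ⟩
      hom (idₛ S ⊠₁ ℓₛ S′) ∘ hom (aₛ S J S′) ∘ q-tensor (S ⊠ J) S′ ∘ (hom (rₛ S) ⊗₁ id)
        -- `hom (rₛ S) ⊗₁ id` is split into its three factors, so that the first one completes the
        -- left side of `a-q S J S′`.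
        ≈⟨ refl⟩∘⟨ refl⟩∘⟨ refl⟩∘⟨ trans (refl⟩∘⟨ ⊗-mergeˡ refl) (⊗-mergeˡ refl) ⟨
      hom (idₛ S ⊠₁ ℓₛ S′) ∘ hom (aₛ S J S′) ∘ q-tensor (S ⊠ J) S′
        ∘ (q-tensor S J ⊗₁ id) ∘ ((id ⊗₁ q-unit) ⊗₁ id) ∘ (unitorʳ (dom S) ⊗₁ id)
        ≈⟨ refl⟩∘⟨ extendʳ₃ (a-q S J S′) ⟩
      hom (idₛ S ⊠₁ ℓₛ S′) ∘ q-tensor S (J ⊠ S′) ∘ (id ⊗₁ q-tensor J S′)
        ∘ associator (dom S) (dom J) (dom S′) ∘ ((id ⊗₁ q-unit) ⊗₁ id)
        ∘ (unitorʳ (dom S) ⊗₁ id)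
        ≈⟨ refl⟩∘⟨ refl⟩∘⟨ refl⟩∘⟨ extendʳ (associator-natural id q-unit id) ⟩
      hom (idₛ S ⊠₁ ℓₛ S′) ∘ q-tensor S (J ⊠ S′) ∘ (id ⊗₁ q-tensor J S′)
        ∘ (id ⊗₁ (q-unit ⊗₁ id)) ∘ associator (dom S) unit (dom S′)
        ∘ (unitorʳ (dom S) ⊗₁ id)
        ≈⟨ extendʳ (⊠-q (idₛ S) (ℓₛ S′)) ⟩
      q-tensor S S′ ∘ (id ⊗₁ hom (ℓₛ S′)) ∘ (id ⊗₁ q-tensor J S′)
        ∘ (id ⊗₁ (q-unit ⊗₁ id)) ∘ associator (dom S) unit (dom S′)
        ∘ (unitorʳ (dom S) ⊗₁ id)
        -- The three maps whiskered by `id` on the left merge into the left side of `ℓ-q S′`.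
        ≈⟨ refl⟩∘⟨ pullˡ₃ (trans (refl⟩∘⟨ ⊗-mergeʳ refl) (⊗-mergeʳ (ℓ-q S′))) ⟩
      q-tensor S S′ ∘ (id ⊗₁ unitorˡ (dom S′)) ∘ associator (dom S) unit (dom S′)
        ∘ (unitorʳ (dom S) ⊗₁ id)
        ≈⟨ refl⟩∘⟨ unit-middle (dom S) (dom S′) ⟩
      q-tensor S S′ ∘ id
        ≈⟨ id-commutes ⟨
      id ∘ q-tensor S S′ ∎)

  ℓ-a : ∀ S S′ → hom (ℓₛ (S ⊠ S′)) ∘ hom (aₛ J S S′) ≈ hom (ℓₛ S ⊠₁ idₛ S′)
  ℓ-a S S′ =
    E-cancel (ℓₛ (S ⊠ S′) ∘ₛ aₛ J S S′) (ℓₛ S ⊠₁ idₛ S′)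
             -- The test map starts from the unit of C rather than from `dom J`, since `ℓ-q`
             -- describes the left unitor only after `q-unit`.
             (E-∘ (q-tensor∈E (J ⊠ S) S′) (closed S′ (qₗ∈E S))) (begin
      (hom (ℓₛ (S ⊠ S′)) ∘ hom (aₛ J S S′)) ∘ q-tensor (J ⊠ S) S′ ∘ (qₗ S ⊗₁ id)
        ≈⟨ assoc ⟩
      hom (ℓₛ (S ⊠ S′)) ∘ hom (aₛ J S S′) ∘ q-tensor (J ⊠ S) S′ ∘ (qₗ S ⊗₁ id)
        ≈⟨ refl⟩∘⟨ refl⟩∘⟨ refl⟩∘⟨ ⊗-mergeˡ refl ⟨
      hom (ℓₛ (S ⊠ S′)) ∘ hom (aₛ J S S′) ∘ q-tensor (J ⊠ S) S′
        ∘ (q-tensor J S ⊗₁ id) ∘ ((q-unit ⊗₁ id) ⊗₁ id)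
        ≈⟨ refl⟩∘⟨ extendʳ₃ (a-q J S S′) ⟩
      hom (ℓₛ (S ⊠ S′)) ∘ q-tensor J (S ⊠ S′) ∘ (id ⊗₁ q-tensor S S′)
        ∘ associator (dom J) (dom S) (dom S′) ∘ ((q-unit ⊗₁ id) ⊗₁ id)
        ≈⟨ refl⟩∘⟨ refl⟩∘⟨ refl⟩∘⟨ associator-naturalˡ q-unit ⟩
      hom (ℓₛ (S ⊠ S′)) ∘ q-tensor J (S ⊠ S′) ∘ (id ⊗₁ q-tensor S S′)
        ∘ (q-unit ⊗₁ id) ∘ associator unit (dom S) (dom S′)
        ≈⟨ refl⟩∘⟨ refl⟩∘⟨ extendʳ ⊗-interchange ⟩
      hom (ℓₛ (S ⊠ S′)) ∘ q-tensor J (S ⊠ S′) ∘ (q-unit ⊗₁ id)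
        ∘ (id ⊗₁ q-tensor S S′) ∘ associator unit (dom S) (dom S′)
        ≈⟨ pullˡ₃ (ℓ-q (S ⊠ S′)) ⟩
      unitorˡ (dom (S ⊠ S′)) ∘ (id ⊗₁ q-tensor S S′) ∘ associator unit (dom S) (dom S′)
        ≈⟨ extendʳ (unitorˡ-natural (q-tensor S S′)) ⟩
      q-tensor S S′ ∘ unitorˡ (dom S ⊗₀ dom S′) ∘ associator unit (dom S) (dom S′)
        ≈⟨ refl⟩∘⟨ unit-left (dom S) (dom S′) ⟩
      q-tensor S S′ ∘ (unitorˡ (dom S) ⊗₁ id)
        ≈⟨ refl⟩∘⟨ ⊗-mergeˡ (ℓ-q S) ⟨
      q-tensor S S′ ∘ (hom (ℓₛ S) ⊗₁ id) ∘ (qₗ S ⊗₁ id)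
        ≈⟨ extendʳ (⊠-q (ℓₛ S) (idₛ S′)) ⟨
      hom (ℓₛ S ⊠₁ idₛ S′) ∘ q-tensor (J ⊠ S) S′ ∘ (qₗ S ⊗₁ id) ∎)

  -- Naturality of the right unitor at `q-tensor S S′`, followed by interchange, produces the
  -- composite `q₃ S S′ J` that `a-q` rewrites; what remains is the corresponding axiom of C.
  a-r : ∀ S S′ → hom (aₛ S S′ J) ∘ hom (rₛ (S ⊠ S′)) ≈ hom (idₛ S ⊠₁ rₛ S′)
  a-r S S′ =
    E-cancel (aₛ S S′ J ∘ₛ rₛ (S ⊠ S′)) (idₛ S ⊠₁ rₛ S′) (q-tensor∈E S S′) (begin
      (hom (aₛ S S′ J) ∘ hom (rₛ (S ⊠ S′))) ∘ q-tensor S S′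
        ≈⟨ trans assoc (refl⟩∘⟨ trans assoc (refl⟩∘⟨ assoc)) ⟩
      hom (aₛ S S′ J) ∘ q-tensor (S ⊠ S′) J ∘ (id ⊗₁ q-unit)
        ∘ unitorʳ (dom (S ⊠ S′)) ∘ q-tensor S S′
        ≈⟨ refl⟩∘⟨ refl⟩∘⟨ refl⟩∘⟨ unitorʳ-natural (q-tensor S S′) ⟩
      hom (aₛ S S′ J) ∘ q-tensor (S ⊠ S′) J ∘ (id ⊗₁ q-unit)
        ∘ (q-tensor S S′ ⊗₁ id) ∘ unitorʳ (dom S ⊗₀ dom S′)
        ≈⟨ refl⟩∘⟨ refl⟩∘⟨ extendʳ ⊗-interchange ⟩
      hom (aₛ S S′ J) ∘ q-tensor (S ⊠ S′) J ∘ (q-tensor S S′ ⊗₁ id)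
        ∘ (id ⊗₁ q-unit) ∘ unitorʳ (dom S ⊗₀ dom S′)
        ≈⟨ extendʳ₃ (a-q S S′ J) ⟩
      q-tensor S (S′ ⊠ J) ∘ (id ⊗₁ q-tensor S′ J) ∘ associator (dom S) (dom S′) (dom J)
        ∘ (id ⊗₁ q-unit) ∘ unitorʳ (dom S ⊗₀ dom S′)
        ≈⟨ refl⟩∘⟨ refl⟩∘⟨ extendʳ (associator-naturalʳ q-unit) ⟩
      q-tensor S (S′ ⊠ J) ∘ (id ⊗₁ q-tensor S′ J) ∘ (id ⊗₁ (id ⊗₁ q-unit))
        ∘ associator (dom S) (dom S′) unit ∘ unitorʳ (dom S ⊗₀ dom S′)
        ≈⟨ refl⟩∘⟨ refl⟩∘⟨ refl⟩∘⟨ unit-right (dom S) (dom S′) ⟩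
      q-tensor S (S′ ⊠ J) ∘ (id ⊗₁ q-tensor S′ J) ∘ (id ⊗₁ (id ⊗₁ q-unit))
        ∘ (id ⊗₁ unitorʳ (dom S′))
        -- The merged right-hand factor is `hom (rₛ S′)` by definition.
        ≈⟨ refl⟩∘⟨ trans (refl⟩∘⟨ ⊗-mergeʳ refl) (⊗-mergeʳ refl) ⟩
      q-tensor S (S′ ⊠ J) ∘ (id ⊗₁ hom (rₛ S′))
        ≈⟨ ⊠-q (idₛ S) (rₛ S′) ⟨
      hom (idₛ S ⊠₁ rₛ S′) ∘ q-tensor S S′ ∎)

  -- Precomposed with the fourfold map q, each side becomes one common composite of maps q after the
  -- matching side of the pentagon in C.
  a-pentagon : ∀ S₁ S₂ S₃ S₄ →
    hom (idₛ S₁ ⊠₁ aₛ S₂ S₃ S₄) ∘ hom (aₛ S₁ (S₂ ⊠ S₃) S₄)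
        ∘ hom (aₛ S₁ S₂ S₃ ⊠₁ idₛ S₄)
      ≈ hom (aₛ S₁ S₂ (S₃ ⊠ S₄)) ∘ hom (aₛ (S₁ ⊠ S₂) S₃ S₄)
  a-pentagon S₁ S₂ S₃ S₄ =
    E-cancel
      ((idₛ S₁ ⊠₁ aₛ S₂ S₃ S₄) ∘ₛ aₛ S₁ (S₂ ⊠ S₃) S₄ ∘ₛ (aₛ S₁ S₂ S₃ ⊠₁ idₛ S₄))
      (aₛ S₁ S₂ (S₃ ⊠ S₄) ∘ₛ aₛ (S₁ ⊠ S₂) S₃ S₄)
      (E-∘ (q-tensor∈E ((S₁ ⊠ S₂) ⊠ S₃) S₄) (closed S₄ (q₃∈E S₁ S₂ S₃)))
      (trans via-S₂⊠S₃ (trans (refl⟩∘⟨ refl⟩∘⟨ refl⟩∘⟨ pentagon D₁ D₂ D₃ D₄) (sym via-S₁⊠S₂)))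
    where
      D₁ = dom S₁
      D₂ = dom S₂
      D₃ = dom S₃
      D₄ = dom S₄

      -- The associators are resolved from the innermost outwards: the first by `a-q` whiskered with
      -- `S₄`, the second by `a-q` at `S₂ ⊠ S₃`, the third by `a-q` whiskered with `S₁`. Naturality
      -- in the middle variable connects the last two.
      via-S₂⊠S₃ :
        (hom (idₛ S₁ ⊠₁ aₛ S₂ S₃ S₄) ∘ hom (aₛ S₁ (S₂ ⊠ S₃) S₄)
            ∘ hom (aₛ S₁ S₂ S₃ ⊠₁ idₛ S₄))
          ∘ q-tensor ((S₁ ⊠ S₂) ⊠ S₃) S₄ ∘ (q₃ S₁ S₂ S₃ ⊗₁ id)
        ≈ q-tensor S₁ (S₂ ⊠ (S₃ ⊠ S₄)) ∘ (id ⊗₁ q-tensor S₂ (S₃ ⊠ S₄))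
            ∘ (id ⊗₁ (id ⊗₁ q-tensor S₃ S₄))
            ∘ (id ⊗₁ associator D₂ D₃ D₄) ∘ associator D₁ (D₂ ⊗₀ D₃) D₄
            ∘ (associator D₁ D₂ D₃ ⊗₁ id)
      via-S₂⊠S₃ = begin
        (hom (idₛ S₁ ⊠₁ aₛ S₂ S₃ S₄) ∘ hom (aₛ S₁ (S₂ ⊠ S₃) S₄)
            ∘ hom (aₛ S₁ S₂ S₃ ⊠₁ idₛ S₄))
          ∘ q-tensor ((S₁ ⊠ S₂) ⊠ S₃) S₄ ∘ (q₃ S₁ S₂ S₃ ⊗₁ id)
          ≈⟨ trans assoc (refl⟩∘⟨ assoc) ⟩
        hom (idₛ S₁ ⊠₁ aₛ S₂ S₃ S₄) ∘ hom (aₛ S₁ (S₂ ⊠ S₃) S₄)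
          ∘ hom (aₛ S₁ S₂ S₃ ⊠₁ idₛ S₄)
          ∘ q-tensor ((S₁ ⊠ S₂) ⊠ S₃) S₄ ∘ (q₃ S₁ S₂ S₃ ⊗₁ id)
          ≈⟨ refl⟩∘⟨ refl⟩∘⟨ extendʳ (⊠-q (aₛ S₁ S₂ S₃) (idₛ S₄)) ⟩
        hom (idₛ S₁ ⊠₁ aₛ S₂ S₃ S₄) ∘ hom (aₛ S₁ (S₂ ⊠ S₃) S₄)
          ∘ q-tensor (S₁ ⊠ (S₂ ⊠ S₃)) S₄
          ∘ (hom (aₛ S₁ S₂ S₃) ⊗₁ id) ∘ (q₃ S₁ S₂ S₃ ⊗₁ id)
          ≈⟨ refl⟩∘⟨ refl⟩∘⟨ refl⟩∘⟨ ⊗-mergeˡ (a-q S₁ S₂ S₃) ⟩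
        hom (idₛ S₁ ⊠₁ aₛ S₂ S₃ S₄) ∘ hom (aₛ S₁ (S₂ ⊠ S₃) S₄)
          ∘ q-tensor (S₁ ⊠ (S₂ ⊠ S₃)) S₄
          ∘ ((q-tensor S₁ (S₂ ⊠ S₃) ∘ (id ⊗₁ q-tensor S₂ S₃) ∘ associator D₁ D₂ D₃) ⊗₁ id)
          ≈⟨ refl⟩∘⟨ refl⟩∘⟨ refl⟩∘⟨ trans (refl⟩∘⟨ ⊗-mergeˡ refl) (⊗-mergeˡ refl) ⟨
        hom (idₛ S₁ ⊠₁ aₛ S₂ S₃ S₄) ∘ hom (aₛ S₁ (S₂ ⊠ S₃) S₄)
          ∘ q-tensor (S₁ ⊠ (S₂ ⊠ S₃)) S₄ ∘ (q-tensor S₁ (S₂ ⊠ S₃) ⊗₁ id)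
          ∘ ((id ⊗₁ q-tensor S₂ S₃) ⊗₁ id) ∘ (associator D₁ D₂ D₃ ⊗₁ id)
          ≈⟨ refl⟩∘⟨ extendʳ₃ (a-q S₁ (S₂ ⊠ S₃) S₄) ⟩
        hom (idₛ S₁ ⊠₁ aₛ S₂ S₃ S₄) ∘ q-tensor S₁ ((S₂ ⊠ S₃) ⊠ S₄)
          ∘ (id ⊗₁ q-tensor (S₂ ⊠ S₃) S₄) ∘ associator D₁ (dom (S₂ ⊠ S₃)) D₄
          ∘ ((id ⊗₁ q-tensor S₂ S₃) ⊗₁ id) ∘ (associator D₁ D₂ D₃ ⊗₁ id)
          ≈⟨ refl⟩∘⟨ refl⟩∘⟨ refl⟩∘⟨ extendʳ (associator-natural id (q-tensor S₂ S₃) id) ⟩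
        hom (idₛ S₁ ⊠₁ aₛ S₂ S₃ S₄) ∘ q-tensor S₁ ((S₂ ⊠ S₃) ⊠ S₄)
          ∘ (id ⊗₁ q-tensor (S₂ ⊠ S₃) S₄) ∘ (id ⊗₁ (q-tensor S₂ S₃ ⊗₁ id))
          ∘ associator D₁ (D₂ ⊗₀ D₃) D₄ ∘ (associator D₁ D₂ D₃ ⊗₁ id)
          ≈⟨ extendʳ (⊠-q (idₛ S₁) (aₛ S₂ S₃ S₄)) ⟩
        q-tensor S₁ (S₂ ⊠ (S₃ ⊠ S₄)) ∘ (id ⊗₁ hom (aₛ S₂ S₃ S₄))
          ∘ (id ⊗₁ q-tensor (S₂ ⊠ S₃) S₄) ∘ (id ⊗₁ (q-tensor S₂ S₃ ⊗₁ id))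
          ∘ associator D₁ (D₂ ⊗₀ D₃) D₄ ∘ (associator D₁ D₂ D₃ ⊗₁ id)
          ≈⟨ refl⟩∘⟨ extendʳ₃ whiskered-a-q ⟩
        q-tensor S₁ (S₂ ⊠ (S₃ ⊠ S₄)) ∘ (id ⊗₁ q-tensor S₂ (S₃ ⊠ S₄))
          ∘ (id ⊗₁ (id ⊗₁ q-tensor S₃ S₄)) ∘ (id ⊗₁ associator D₂ D₃ D₄)
          ∘ associator D₁ (D₂ ⊗₀ D₃) D₄ ∘ (associator D₁ D₂ D₃ ⊗₁ id) ∎
        where
          -- This is `a-q S₂ S₃ S₄` under `id ⊗₁ _`, with both sides split back into three factors
          -- to fit `extendʳ₃`.
          whiskered-a-q =
            trans (trans (refl⟩∘⟨ ⊗-mergeʳ refl) (⊗-mergeʳ (a-q S₂ S₃ S₄)))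
                  (sym (trans (refl⟩∘⟨ ⊗-mergeʳ refl) (⊗-mergeʳ refl)))

      -- `q-tensor S₁ S₂` and `q-tensor S₃ S₄` act on different factors; interchanging them turns
      -- the output of the inner `a-q` into the input of the outer one.
      via-S₁⊠S₂ :
        (hom (aₛ S₁ S₂ (S₃ ⊠ S₄)) ∘ hom (aₛ (S₁ ⊠ S₂) S₃ S₄))
          ∘ q-tensor ((S₁ ⊠ S₂) ⊠ S₃) S₄ ∘ (q₃ S₁ S₂ S₃ ⊗₁ id)
        ≈ q-tensor S₁ (S₂ ⊠ (S₃ ⊠ S₄)) ∘ (id ⊗₁ q-tensor S₂ (S₃ ⊠ S₄))
            ∘ (id ⊗₁ (id ⊗₁ q-tensor S₃ S₄))
            ∘ associator D₁ D₂ (D₃ ⊗₀ D₄) ∘ associator (D₁ ⊗₀ D₂) D₃ D₄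
      via-S₁⊠S₂ = begin
        (hom (aₛ S₁ S₂ (S₃ ⊠ S₄)) ∘ hom (aₛ (S₁ ⊠ S₂) S₃ S₄))
          ∘ q-tensor ((S₁ ⊠ S₂) ⊠ S₃) S₄ ∘ (q₃ S₁ S₂ S₃ ⊗₁ id)
          ≈⟨ assoc ⟩
        hom (aₛ S₁ S₂ (S₃ ⊠ S₄)) ∘ hom (aₛ (S₁ ⊠ S₂) S₃ S₄)
          ∘ q-tensor ((S₁ ⊠ S₂) ⊠ S₃) S₄ ∘ (q₃ S₁ S₂ S₃ ⊗₁ id)
          ≈⟨ refl⟩∘⟨ refl⟩∘⟨ refl⟩∘⟨ ⊗-mergeˡ refl ⟨
        hom (aₛ S₁ S₂ (S₃ ⊠ S₄)) ∘ hom (aₛ (S₁ ⊠ S₂) S₃ S₄)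
          ∘ q-tensor ((S₁ ⊠ S₂) ⊠ S₃) S₄
          ∘ (q-tensor (S₁ ⊠ S₂) S₃ ⊗₁ id) ∘ ((q-tensor S₁ S₂ ⊗₁ id) ⊗₁ id)
          ≈⟨ refl⟩∘⟨ extendʳ₃ (a-q (S₁ ⊠ S₂) S₃ S₄) ⟩
        hom (aₛ S₁ S₂ (S₃ ⊠ S₄)) ∘ q-tensor (S₁ ⊠ S₂) (S₃ ⊠ S₄)
          ∘ (id ⊗₁ q-tensor S₃ S₄) ∘ associator (dom (S₁ ⊠ S₂)) D₃ D₄
          ∘ ((q-tensor S₁ S₂ ⊗₁ id) ⊗₁ id)
          ≈⟨ refl⟩∘⟨ refl⟩∘⟨ refl⟩∘⟨ associator-naturalˡ (q-tensor S₁ S₂) ⟩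
        hom (aₛ S₁ S₂ (S₃ ⊠ S₄)) ∘ q-tensor (S₁ ⊠ S₂) (S₃ ⊠ S₄)
          ∘ (id ⊗₁ q-tensor S₃ S₄) ∘ (q-tensor S₁ S₂ ⊗₁ id)
          ∘ associator (D₁ ⊗₀ D₂) D₃ D₄
          ≈⟨ refl⟩∘⟨ refl⟩∘⟨ extendʳ ⊗-interchange ⟩
        hom (aₛ S₁ S₂ (S₃ ⊠ S₄)) ∘ q-tensor (S₁ ⊠ S₂) (S₃ ⊠ S₄)
          ∘ (q-tensor S₁ S₂ ⊗₁ id) ∘ (id ⊗₁ q-tensor S₃ S₄)
          ∘ associator (D₁ ⊗₀ D₂) D₃ D₄
          ≈⟨ extendʳ₃ (a-q S₁ S₂ (S₃ ⊠ S₄)) ⟩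
        q-tensor S₁ (S₂ ⊠ (S₃ ⊠ S₄)) ∘ (id ⊗₁ q-tensor S₂ (S₃ ⊠ S₄))
          ∘ associator D₁ D₂ (dom (S₃ ⊠ S₄)) ∘ (id ⊗₁ q-tensor S₃ S₄)
          ∘ associator (D₁ ⊗₀ D₂) D₃ D₄
          ≈⟨ refl⟩∘⟨ refl⟩∘⟨ extendʳ (associator-naturalʳ (q-tensor S₃ S₄)) ⟩
        q-tensor S₁ (S₂ ⊠ (S₃ ⊠ S₄)) ∘ (id ⊗₁ q-tensor S₂ (S₃ ⊠ S₄))
          ∘ (id ⊗₁ (id ⊗₁ q-tensor S₃ S₄))
          ∘ associator D₁ D₂ (D₃ ⊗₀ D₄) ∘ associator (D₁ ⊗₀ D₂) D₃ D₄ ∎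

  -- The skew monoidal structure, left normality and monoidality.

  slice-isLeftSkewMonoidal : IsLeftSkewMonoidal sliceRaw
  slice-isLeftSkewMonoidal = record
    -- Equality in M/T compares only `hom` parts, so the slice morphisms are passed on explicitly
    -- instead of being left to unification.
    { ⊗-resp-≈           = λ {_} {_} {_} {_} {f} {g} {h} {i} → ⊠-resp-≈ f g h i
    ; ⊗-id               = λ {S} {S′} → ⊠-id S S′
    ; ⊗-∘                = λ {_} {_} {_} {_} {_} {_} {f} {f′} {g} {g′} → ⊠-∘ f f′ g g′
    ; unitorˡ-natural    = ℓ-natural
    ; unitorʳ-natural    = r-natural
    ; associator-natural = a-natural
    ; unit-unit          = ℓ-r-unit
    ; unit-middle        = ℓ-a-r
    ; unit-left          = ℓ-a
    ; unit-right         = a-r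
    ; pentagon           = a-pentagon
    }

  -- By `ℓ-q`, the left unitor after `qₗ S` is the left unitor of C, an isomorphism and hence in E;
  -- `E-iso` applies with `qₗ S`.
  slice-isLeftNormal : IsLeftNormal raw → IsLeftNormal sliceRaw
  slice-isLeftNormal λ-iso S =
    E-iso (ℓₛ S) (qₗ∈E S) (E-resp-≈ (sym (ℓ-q S)) (iso⇒E (λ-iso (dom S))))

  -- Closure under tensoring on the left puts `id ⊗₁ q-unit` and `id ⊗₁ q-tensor S′ S″` in E. With
  -- the isomorphisms of C, this puts `hom (rₛ S)` and the right side of `a-q` in E, as `E-iso`
  -- requires.
  slice-isMonoidal : ClosedUnder-S⊗ V 𝕋 F → IsMonoidal raw → IsMonoidal sliceRaw
  slice-isMonoidal closedʳ monoidal = record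
    { isLeftSkewMonoidal = slice-isLeftSkewMonoidal
    ; unitorˡ-iso        = slice-isLeftNormal unitorˡ-iso
    ; unitorʳ-iso        = λ S →
        -- The test map is `id`, because the right unitor itself lies in E.
        E-iso (rₛ S) (iso⇒E id-isIso)
          (E-resp-≈ (sym identityʳ)
            (E-∘ (q-tensor∈E S J)
                 (E-∘ (closedʳ S q-unit∈E) (iso⇒E (unitorʳ-iso (dom S))))))
    ; associator-iso     = λ S S′ S″ →
        E-iso (aₛ S S′ S″) (q₃∈E S S′ S″)
          (E-resp-≈ (sym (a-q S S′ S″))
            (E-∘ (q-tensor∈E S (S′ ⊠ S″))
                 (E-∘ (closedʳ S (q-tensor∈E S′ S″))
                      (iso⇒E (associator-iso (dom S) (dom S′) (dom S″))))))
    }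
    where open IsMonoidal monoidal using (unitorˡ-iso; unitorʳ-iso; associator-iso)

theorem3p9 : ∀ {o ℓ e p q} (C : Category o ℓ e) (V : LeftSkewMonoidal C) (𝕋 : MonoidIn V)
    (F : OrthogonalFactorizationSystem C p q)
    (closed : ClosedUnder-⊗S V 𝕋 F)
    (choice : ChosenFactorizations V 𝕋 F) →
    let open SliceStructure 𝕋 F closed choice using (sliceRaw) in
    IsLeftSkewMonoidal sliceRaw
    × (IsLeftNormal (LeftSkewMonoidal.raw V) → IsLeftNormal sliceRaw)
    × (ClosedUnder-S⊗ V 𝕋 F → IsMonoidal (LeftSkewMonoidal.raw V) → IsMonoidal sliceRaw)
theorem3p9 C V 𝕋 F closed choice =
  slice-isLeftSkewMonoidal , slice-isLeftNormal , slice-isMonoidal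
  where open SliceSkewMonoidal 𝕋 F closed choice
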